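{- For every integer $d\ge 3$ and all positive integers $n_1,\ldots,n_d$, the grid graph $P_{n_1}\square P_{n_2}\square\cdots\square P_{n_d}$ is a $(d-1)$-interval-PCG.
   Context: All graphs are finite, simple, undirected, with nonempty vertex set. A weighted tree is a finite tree with strictly positive real edge weights. For a weighted tree $T$ and vertices $x,y$ of $T$, $d_T(x,y)$ is the total weight of the unique $x$–$y$ path, and $L(T)$ is the set of leaves of $T$ (the vertex of a one-vertex tree counts as a leaf). Grid graph: for positive integers $n_1,\ldots,n_d$, the graph $P_{n_1}\square\cdots\square P_{n_d}$ has vertex set $\{(x_1,\ldots,x_d)\in\mathbb{Z}^d: 0\le x_i\le n_i-1 \text{ for every } i\in\{1,\ldots,d\}\}$; two vertices are adjacent if and only if they differ by $1$ in exactly one coordinate and agree in every other coordinate. $k$-interval-PCG ($k\ge 1$): a graph $G=(V,E)$ is a $k$-interval-PCG if there exist a weighted tree $T$, a bijection $\zeta:V\to L(T)$, and pairwise disjoint closed intervals $I_1,\ldots,I_k$ such that for every pair of distinct vertices $u,v\in V$, $uv\in E$ if and only if $d_T(\zeta(u),\zeta(v))\in\bigcup_{j=1}^k I_j$. -}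

module Defs where

open import Data.Fin as Fin using (Fin; toℕ)
import Data.Fin.Properties as Fin
open import Data.Integer using (+_)
open import Data.List using (List; []; _∷_; length)
open import Data.List.Relation.Unary.Unique.Propositional using (Unique)
open import Data.Nat as ℕ using (ℕ; zero; suc; ∣_-_∣)
import Data.Nat.Properties as ℕ
open import Data.Nat.Solver using (module +-*-Solver)
open import Data.Product using (Σ; ∃; ∃-syntax; _×_; _,_; proj₁; uncurry)
open import Data.Product.Function.NonDependent.Propositional using (_×-↔_)
open import Data.Rational as ℚ using (ℚ; 0ℚ; _/_)
import Data.Rational.Properties as ℚ
open import Data.Rational.Solver using () renaming (module +-*-Solver to ℚ-Solver)
open import Data.Rational.Unnormalised as ℚᵘ using (mkℚᵘ; *≡*)
import Data.Rational.Unnormalised.Properties as ℚᵘ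
open import Data.Sum using (_⊎_)
open import Data.Vec using (Vec; []; _∷_)
open import Data.Vec.Relation.Unary.All as All using (All; []; _∷_)
open import Data.Vec.Relation.Unary.All.Properties using (lookup⁺)
open import Function using (_on_)
open import Function.Bundles using (_↔_; _⇔_; mk↔ₛ′)
open import Function.Construct.Composition using (_↔-∘_)
open import Function.Construct.Identity using (↔-id)
open import Function.Construct.Symmetry using (↔-sym)
open import Function.Definitions using (Bijective)
open import Relation.Binary.Construct.Closure.ReflexiveTransitive using (Star; ε; _◅_)
open import Relation.Binary.Definitions using (Symmetric; Irreflexive; Decidable)
open import Relation.Binary.PropositionalEquality
open import Relation.Nullary using (¬_)
open import Relation.Nullary.Decidable using (_×-dec_; _→-dec_; ¬?)

------------------------------------------------------------------------
-- Real numbers, after Bishop: regular sequences of rationals.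

1/suc : ℕ → ℚ
1/suc n = + 1 / suc n

2/suc : ℕ → ℚ
2/suc n = + 2 / suc n

record ℝ : Set where
  constructor mkℝ
  field
    seq     : ℕ → ℚ
    regular : ∀ m n → ℚ.∣ seq m ℚ.- seq n ∣ ℚ.≤ 1/suc m ℚ.+ 1/suc n

open ℝ public

infix 4 _≤ᴿ_ _<ᴿ_ _≃ᴿ_

-- The n-th term is within 1/(n+1) of the limit, hence the tolerance
-- 2/(n+1) when two n-th terms are compared.

_≤ᴿ_ : ℝ → ℝ → Set
x ≤ᴿ y = ∀ n → seq x n ℚ.≤ seq y n ℚ.+ 2/suc n

_<ᴿ_ : ℝ → ℝ → Set
x <ᴿ y = ∃[ n ] seq x n ℚ.+ 2/suc n ℚ.< seq y n

_≃ᴿ_ : ℝ → ℝ → Set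
x ≃ᴿ y = x ≤ᴿ y × y ≤ᴿ x

private
  0≤1/suc : ∀ n → 0ℚ ℚ.≤ 1/suc n
  0≤1/suc n = ℚ.nonNegative⁻¹ (1/suc n) {{ℚ.normalize-nonNeg 1 (suc n)}}

fromℚ : ℚ → ℝ
fromℚ q .seq _ = q
fromℚ q .regular m n = begin
  ℚ.∣ q ℚ.- q ∣          ≡⟨ cong ℚ.∣_∣ (ℚ.+-inverseʳ q) ⟩
  0ℚ ℚ.+ 0ℚ              ≤⟨ ℚ.+-mono-≤ (0≤1/suc m) (0≤1/suc n) ⟩
  1/suc m ℚ.+ 1/suc n    ∎
  where open ℚ.≤-Reasoning

0ℝ : ℝ
0ℝ = fromℚ 0ℚ

refine : ℕ → ℕ
refine n = suc (n ℕ.+ n)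

private
  half+half : ∀ n → 1/suc (refine n) ℚ.+ 1/suc (refine n) ≡ 1/suc n
  half+half n = ℚ.toℚᵘ-injective (begin-equality
    ℚ.toℚᵘ (h ℚ.+ h)          ≃⟨ ℚ.toℚᵘ-homo-+ h h ⟩
    ℚ.toℚᵘ h ℚᵘ.+ ℚ.toℚᵘ h    ≃⟨ ℚᵘ.+-cong h≃ h≃ ⟩
    hᵘ ℚᵘ.+ hᵘ                ≃⟨ *≡* (cong +_ (eq n)) ⟩
    mkℚᵘ (+ 1) n              ≃⟨ ℚ.toℚᵘ-fromℚᵘ (mkℚᵘ (+ 1) n) ⟨
    ℚ.toℚᵘ (1/suc n)          ∎)
    where
    open ℚᵘ.≤-Reasoning
    h  = 1/suc (refine n)
    hᵘ = mkℚᵘ (+ 1) (refine n)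
    h≃ = ℚ.toℚᵘ-fromℚᵘ hᵘ
    eq : ∀ n → (1 ℕ.* suc (refine n) ℕ.+ 1 ℕ.* suc (refine n)) ℕ.* suc n
             ≡ 1 ℕ.* (suc (refine n) ℕ.* suc (refine n))
    eq = +-*-Solver.solve 1 (λ n →
      let d = con 1 :+ (con 1 :+ (n :+ n)) in
      (con 1 :* d :+ con 1 :* d) :* (con 1 :+ n) := con 1 :* (d :* d)) refl
      where open +-*-Solver

infixl 6 _+ᴿ_

_+ᴿ_ : ℝ → ℝ → ℝ
(x +ᴿ y) .seq n = seq x (refine n) ℚ.+ seq y (refine n)
(x +ᴿ y) .regular m n = begin
  ℚ.∣ (a ℚ.+ b) ℚ.- (c ℚ.+ d) ∣                ≡⟨ cong ℚ.∣_∣ (swap₁ a b c d) ⟩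
  ℚ.∣ (a ℚ.- c) ℚ.+ (b ℚ.- d) ∣                ≤⟨ ℚ.∣p+q∣≤∣p∣+∣q∣ (a ℚ.- c) (b ℚ.- d) ⟩
  ℚ.∣ a ℚ.- c ∣ ℚ.+ ℚ.∣ b ℚ.- d ∣              ≤⟨ ℚ.+-mono-≤ (regular x (refine m) (refine n))
                                                               (regular y (refine m) (refine n)) ⟩
  (p ℚ.+ q) ℚ.+ (p ℚ.+ q)                      ≡⟨ swap₂ p q ⟩
  (p ℚ.+ p) ℚ.+ (q ℚ.+ q)                      ≡⟨ cong₂ ℚ._+_ (half+half m) (half+half n) ⟩
  1/suc m ℚ.+ 1/suc n                          ∎
  where
  open ℚ.≤-Reasoning
  a = seq x (refine m)
  b = seq y (refine m)
  c = seq x (refine n)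
  d = seq y (refine n)
  p = 1/suc (refine m)
  q = 1/suc (refine n)
  open ℚ-Solver
  swap₁ : ∀ a b c d → (a ℚ.+ b) ℚ.- (c ℚ.+ d) ≡ (a ℚ.- c) ℚ.+ (b ℚ.- d)
  swap₁ = solve 4 (λ a b c d → (a :+ b) :- (c :+ d) := (a :- c) :+ (b :- d)) refl
  swap₂ : ∀ p q → (p ℚ.+ q) ℚ.+ (p ℚ.+ q) ≡ (p ℚ.+ p) ℚ.+ (q ℚ.+ q)
  swap₂ = solve 2 (λ p q → (p :+ q) :+ (p :+ q) := (p :+ p) :+ (q :+ q)) refl

record ClosedInterval : Set where
  field
    lo hi : ℝ
    lo≤hi : lo ≤ᴿ hi

infix 4 _∈ᴵ_

_∈ᴵ_ : ℝ → ClosedInterval → Set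
x ∈ᴵ I = lo ≤ᴿ x × x ≤ᴿ hi
  where open ClosedInterval I

------------------------------------------------------------------------
-- Graphs and trees

record Graph : Set₁ where
  field
    V        : Set
    finite   : ∃[ m ] (V ↔ Fin m)
    nonempty : V
    Adj      : V → V → Set
    adj?     : Decidable Adj
    adj-sym  : Symmetric Adj
    irrefl   : Irreflexive _≡_ Adj

  Walk : V → V → Set
  Walk = Star Adj

  vertices : ∀ {x y} → Walk x y → List V
  vertices {x} ε       = x ∷ []
  vertices {x} (_ ◅ p) = x ∷ vertices p

  Path : V → V → Set
  Path x y = Σ (Walk x y) λ p → Unique (vertices p)

  Connected : Set
  Connected = ∀ x y → Path x y

  -- A cycle is a path on at least three vertices whose ends are adjacent.
  Acyclic : Set
  Acyclic = ∀ {x y} ((p , _) : Path x y) → 3 ℕ.≤ length (vertices p) → ¬ Adj y x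

  -- Degree one, or the only vertex of the graph.
  Leaf : V → Set
  Leaf x = (∃[ y ] Adj x y × (∀ z → Adj x z → z ≡ y)) ⊎ (∀ y → y ≡ x)

record WeightedTree : Set₁ where
  field
    graph : Graph
  open Graph graph public
  field
    connected  : Connected
    acyclic    : Acyclic
    weight     : ∀ {x y} → Adj x y → ℝ
    -- Together with the symmetry of Adj, this also makes the weight
    -- independent of the proof of adjacency.
    weight-sym : ∀ {x y} (e : Adj x y) (e′ : Adj y x) → weight e ≃ᴿ weight e′
    weight-pos : ∀ {x y} (e : Adj x y) → 0ℝ <ᴿ weight e

  walkWeight : ∀ {x y} → Walk x y → ℝ
  walkWeight ε       = 0ℝ
  walkWeight (e ◅ p) = weight e +ᴿ walkWeight p

  -- By acyclicity there is only one path from x to y, so it does not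
  -- matter which one `connected` provides.
  dist : V → V → ℝ
  dist x y = walkWeight (proj₁ (connected x y))

  L : Set
  L = ∃ Leaf

------------------------------------------------------------------------
-- k-interval-PCGs

record IsIntervalPCG (k : ℕ) (G : Graph) : Set₁ where
  open Graph G using (V; Adj)
  field
    1≤k         : 1 ℕ.≤ k
    T           : WeightedTree
  open WeightedTree T using (L; dist)
  field
    ζ           : V → L
    -- Leaves are compared as vertices, ignoring the proof of leafhood.
    ζ-bijective : Bijective _≡_ (_≡_ on proj₁) ζ
    I           : Fin k → ClosedInterval
    disjoint    : ∀ i j → i ≢ j → ∀ r → ¬ (r ∈ᴵ I i × r ∈ᴵ I j)
    adj⇔        : ∀ u v → u ≢ v →
                  Adj u v ⇔ (∃[ j ] dist (proj₁ (ζ u)) (proj₁ (ζ v)) ∈ᴵ I j)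

------------------------------------------------------------------------
-- Grid graphs

-- An element of GridPoint (n₁ ∷ … ∷ n_d ∷ []) is a tuple (x₁ , … , x_d)
-- with 0 ≤ x_i ≤ n_i - 1.
GridPoint : ∀ {d} → Vec ℕ d → Set
GridPoint = All Fin

coord : ∀ {d} {ns : Vec ℕ d} → GridPoint ns → Fin d → ℕ
coord x i = toℕ (lookup⁺ x i)

GridAdj : ∀ {d} {ns : Vec ℕ d} → GridPoint ns → GridPoint ns → Set
GridAdj x y = ∃[ i ] ∣ coord x i - coord y i ∣ ≡ 1
                   × (∀ j → j ≢ i → coord x j ≡ coord y j)

private
  gridSize : ∀ {d} → Vec ℕ d → ℕ
  gridSize []       = 1
  gridSize (n ∷ ns) = n ℕ.* gridSize ns

  gridFinite : ∀ {d} (ns : Vec ℕ d) → GridPoint ns ↔ Fin (gridSize ns)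
  gridFinite []       = mk↔ₛ′ (λ _ → Fin.zero) (λ _ → [])
                          (λ { Fin.zero → refl ; (Fin.suc ()) }) (λ { [] → refl })
  gridFinite (n ∷ ns) =
    ↔-sym Fin.*↔× ↔-∘ ((↔-id (Fin n) ×-↔ gridFinite ns) ↔-∘
    mk↔ₛ′ All.uncons (uncurry _∷_) (λ _ → refl) (λ { (_ ∷ _) → refl }))

  origin : ∀ {d} {ns : Vec ℕ d} → All (1 ℕ.≤_) ns → GridPoint ns
  origin = All.map (λ 0<n → Fin.fromℕ< 0<n)

grid : ∀ {d} (ns : Vec ℕ d) → All (1 ℕ.≤_) ns → Graph
grid ns ns≥1 = record
  { V        = GridPoint ns
  ; finite   = gridSize ns , gridFinite ns
  ; nonempty = origin ns≥1
  ; Adj      = GridAdj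
  ; adj?     = λ x y → Fin.any? λ i →
                 (∣ coord x i - coord y i ∣ ℕ.≟ 1) ×-dec
                 Fin.all? λ j → ¬? (j Fin.≟ i) →-dec (coord x j ℕ.≟ coord y j)
  ; adj-sym  = λ { {x} {y} (i , xy , rest) →
                 i , trans (ℕ.∣-∣-comm (coord y i) (coord x i)) xy
                   , λ j j≢i → sym (rest j j≢i) }
  ; irrefl   = λ { {x} refl (i , xx , _) → ℕ.0≢1+n (trans (sym (ℕ.∣n-n∣≡0 (coord x i))) xx) }
  }

{-# OPTIONS --safe #-}
module Submission where

open import Data.Empty using (⊥)
open import Data.Fin as Fin using (Fin; zero; suc; toℕ; fromℕ<)
import Data.Fin.Properties as Fin
open import Data.List.Relation.Unary.All as ListAll using ([]; _∷_)
open import Data.List.Relation.Unary.AllPairs using ([]; _∷_)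
open import Data.List.Relation.Unary.Unique.Propositional using (Unique)
open import Data.Nat hiding (_/_)
open import Data.Nat.Properties
open import Data.Nat.Tactic.RingSolver using (solve-∀)
open import Data.Product using (Σ; ∃; ∃-syntax; _×_; _,_; proj₁; proj₂)
open import Data.Rational as ℚ using (ℚ; 0ℚ; 1ℚ)
import Data.Rational.Properties as ℚ
open import Data.Sum using (_⊎_; inj₁; inj₂)
open import Data.Sum.Function.Propositional using (_⊎-↔_)
open import Data.Sum.Properties using (inj₂-injective)
open import Data.Unit using (⊤; tt)
open import Data.Vec using (Vec; []; _∷_)
open import Data.Vec.Relation.Unary.All using (All; []; _∷_)
open import Function using (_on_)
open import Function.Definitions using (Bijective; Surjective)
open import Function.Bundles using (_↔_; _⇔_; mk⇔; mk↔ₛ′; Equivalence)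
open import Function.Construct.Composition using (_↔-∘_)
open import Function.Construct.Identity using (↔-id)
open import Function.Construct.Symmetry using (↔-sym)
open import Function.Properties.Inverse using (↔⇒↣)
open import Relation.Binary.Construct.Closure.ReflexiveTransitive using (ε; _◅_)
open import Relation.Binary.Definitions
  using (tri<; tri≈; tri>; DecidableEquality; Symmetric; Irreflexive; Decidable)
open import Relation.Binary.PropositionalEquality
open import Relation.Nullary using (¬_; contradiction; yes; no)
open import Relation.Nullary.Decidable using (from-yes; via-injection; _⊎-dec_)
open import Defs

-- Give each grid point an integer code and hang it at that position of a long
-- path, so that leaves u ≠ v are at distance 2 + ∣code u − code v∣. With the
-- scales of the coordinates growing fast enough, adjacency along a coordinate
-- means that the codes differ by exactly its scale: one interval for each
-- coordinate. One is saved by giving two coordinates the scales B and B + 1,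
-- which share the interval [B , B + 1].

-- Absolute differences and leading digits

∣suc-∣≡1 : ∀ m n → m ≡ suc n → ∣ m - n ∣ ≡ 1
∣suc-∣≡1 _ zero    refl = refl
∣suc-∣≡1 _ (suc n) refl = ∣suc-∣≡1 _ n refl

∣-∣≡1⇒≢ : ∀ m n → ∣ m - n ∣ ≡ 1 → m ≢ n
∣-∣≡1⇒≢ m _ eq refl = 0≢1+n (trans (sym (∣n-n∣≡0 m)) eq)

∣-∣≡1∧m≡1+n+k⇒k≡0 : ∀ m n {k} → ∣ m - n ∣ ≡ 1 → m ≡ suc (n + k) → k ≡ 0
∣-∣≡1∧m≡1+n+k⇒k≡0 _ n {k} eq refl =
  suc-injective (trans (sym (∣m-m+n∣≡n n (suc k)))
    (trans (cong (∣ n -_∣) (+-suc n k)) (trans (∣-∣-comm n (suc (n + k))) eq)))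

∣m-n∣≡1+∣1+m-n∣ : ∀ m n → m < n → ∣ m - n ∣ ≡ suc ∣ suc m - n ∣
∣m-n∣≡1+∣1+m-n∣ zero    (suc n) _         = refl
∣m-n∣≡1+∣1+m-n∣ (suc m) (suc n) (s≤s m<n) = ∣m-n∣≡1+∣1+m-n∣ m n m<n

∣1+m-n∣≡1+∣m-n∣ : ∀ m n → n ≤ m → ∣ suc m - n ∣ ≡ suc ∣ m - n ∣
∣1+m-n∣≡1+∣m-n∣ m       zero    _         = cong suc (sym (∣-∣-identityʳ m))
∣1+m-n∣≡1+∣m-n∣ (suc m) (suc n) (s≤s n≤m) = ∣1+m-n∣≡1+∣m-n∣ m n n≤m

-- The number with leading digit q is the larger one and r < S, so q cannot be below q′. If q
-- exceeds q′ by `suc k`, the surplus `suc k * S` is carried down to the last digits. Keeping δ on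
-- the side of the smaller number avoids truncated subtraction.
digit-gap : ∀ {S} q q′ {r} r′ δ → r < S → q * S + r ≡ δ + (q′ * S + r′) →
            (q ≡ q′ × r ≡ δ + r′) ⊎ (∃[ k ] q ≡ suc (q′ + k) × suc k * S + r ≡ δ + r′)
digit-gap {S} q q′ {r} r′ δ r<S eq with <-cmp q q′
... | tri< q<q′ _ _ = contradiction eq (<⇒≢ (begin-strict
  q * S + r            <⟨ +-monoʳ-< (q * S) r<S ⟩
  q * S + S            ≡⟨ +-comm (q * S) S ⟩
  suc q * S            ≤⟨ *-monoˡ-≤ S q<q′ ⟩
  q′ * S               ≤⟨ m≤m+n (q′ * S) r′ ⟩
  q′ * S + r′          ≤⟨ m≤n+m (q′ * S + r′) δ ⟩
  δ + (q′ * S + r′)    ∎))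
  where open ≤-Reasoning
... | tri≈ _ refl _ = inj₁ (refl , +-cancelˡ-≡ (q * S) _ _ (trans eq (swap δ (q * S) r′)))
  where
  swap : ∀ δ a r → δ + (a + r) ≡ a + (δ + r)
  swap = solve-∀
... | tri> _ _ q′<q with m≤n⇒∃[o]m+o≡n q′<q
... | k , refl = inj₂ (k , refl , +-cancelˡ-≡ (q′ * S) _ _
        (trans (expand q′ k S r) (trans eq (swap δ (q′ * S) r′))))
  where
  swap : ∀ δ a r → δ + (a + r) ≡ a + (δ + r)
  swap = solve-∀
  expand : ∀ q k S r → q * S + ((1 + k) * S + r) ≡ (1 + (q + k)) * S + r
  expand = solve-∀

digits-injective : ∀ {S} q q′ {r r′} → r < S → r′ < S →
                   q * S + r ≡ q′ * S + r′ → q ≡ q′ × r ≡ r′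
digits-injective {S} q q′ {r} {r′} r<S r′<S eq with digit-gap q q′ r′ 0 r<S eq
... | inj₁ p            = p
... | inj₂ (k , _ , eq′) = contradiction (begin
  S                ≤⟨ m≤m+n S (k * S + r) ⟩
  S + (k * S + r)  ≡⟨ +-assoc S (k * S) r ⟨
  suc k * S + r    ≡⟨ eq′ ⟩
  r′               ∎) (<⇒≱ r′<S)
  where open ≤-Reasoning

-- Grid adjacency, one coordinate at a time

coord-injective : ∀ {d} {ns : Vec ℕ d} (x y : GridPoint ns) →
                  (∀ i → coord x i ≡ coord y i) → x ≡ y
coord-injective []       []       _  = refl
coord-injective (x ∷ xs) (y ∷ ys) eq =
  cong₂ _∷_ (Fin.toℕ-injective (eq zero)) (coord-injective xs ys (λ i → eq (suc i)))

gridAdj-∷⁻ : ∀ {d n} {ns : Vec ℕ d} {x y : Fin n} {xs ys : GridPoint ns} →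
             GridAdj (x ∷ xs) (y ∷ ys) →
             (∣ toℕ x - toℕ y ∣ ≡ 1 × xs ≡ ys) ⊎ (x ≡ y × GridAdj xs ys)
gridAdj-∷⁻ {xs = xs} {ys} (zero  , gap , same) =
  inj₁ (gap , coord-injective xs ys (λ i → same (suc i) λ ()))
gridAdj-∷⁻ (suc i , gap , same) =
  inj₂ (Fin.toℕ-injective (same zero λ ()) ,
        i , gap , λ j j≢i → same (suc j) (λ eq → j≢i (Fin.suc-injective eq)))

gridAdj-here : ∀ {d n} {ns : Vec ℕ d} {x y : Fin n} {xs : GridPoint ns} →
               ∣ toℕ x - toℕ y ∣ ≡ 1 → GridAdj (x ∷ xs) (y ∷ xs)
gridAdj-here gap = zero , gap , λ { zero 0≢0 → contradiction refl 0≢0 ; (suc _) _ → refl }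

gridAdj-there : ∀ {d n} {ns : Vec ℕ d} {x : Fin n} {xs ys : GridPoint ns} →
                GridAdj xs ys → GridAdj (x ∷ xs) (x ∷ ys)
gridAdj-there (i , gap , same) =
  suc i , gap , λ { zero _ → refl ; (suc j) j≢i → same j (λ eq → j≢i (cong suc eq)) }

-- Integer codes of grids

-- The points `bottom` and `top` will be the leaves at the two ends of the spine. The number `bound`
-- exceeds all codes and all interval ends, and from it the scale of the next coordinate is
-- computed. In `adj⇔gap`, u is the point with the larger code.
record GridCode (k : ℕ) {d} (ns : Vec ℕ d) : Set where
  field
    code           : GridPoint ns → ℕ
    code-injective : ∀ {u v} → code u ≡ code v → u ≡ v
    bottom top     : GridPoint ns
    code-bottom    : code bottom ≡ 0
    code≤top       : ∀ u → code u ≤ code top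
    lo hi          : Fin k → ℕ
    lo≤hi          : ∀ j → lo j ≤ hi j
    separated      : ∀ i j → i ≢ j → hi i < lo j ⊎ hi j < lo i
    bound          : ℕ
    code<bound     : ∀ u → code u < bound
    hi<bound       : ∀ j → hi j < bound
    adj⇔gap        : ∀ u v δ → code u ≡ δ + code v →
                     GridAdj u v ⇔ (∃[ j ] lo j ≤ δ × δ ≤ hi j)

-- The code of (a , b) is a B + b (B + 1). For s = (a − a′) + (b − b′), two codes
-- differ by s B + (b − b′), which lies in ±[B , B + 1] only for s = ±1 and
-- b − b′ ∈ {0 , s}.
planeCode : ∀ m n → GridCode 1 (suc m ∷ suc n ∷ [])
planeCode m n = record
  { code           = code
  ; code-injective = inj
  ; bottom         = zero ∷ zero ∷ []
  ; top            = Fin.fromℕ m ∷ Fin.fromℕ n ∷ []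
  ; code-bottom    = refl
  ; code≤top       = λ { (a ∷ b ∷ []) → code-top a b }
  ; lo             = λ _ → B
  ; hi             = λ _ → suc B
  ; lo≤hi          = λ _ → n≤1+n B
  ; separated      = λ { zero zero 0≢0 → contradiction refl 0≢0 }
  -- The summand `2 + B` clears `hi`; the remainder is the largest code.
  ; bound          = 2 + B + (m + n) * B + n
  ; code<bound     = λ { (a ∷ b ∷ []) → code-bound a b }
  ; hi<bound       = λ _ → m≤n⇒m≤n+o n (m≤m+n (2 + B) ((m + n) * B))
  ; adj⇔gap        = λ { u@(_ ∷ _ ∷ []) v@(_ ∷ _ ∷ []) δ eq → mk⇔ (to u v δ eq) (from u v δ eq) }
  }
  where
  open ≤-Reasoning
  -- The least B with 2B - n > B + 1: even if `b` drops by n while `a + b` rises by two, the gap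
  -- stays beyond the interval. Also B > n, so `b` is a digit in base B.
  B = 2 + n

  cancel-b : ∀ a a′ b k → a + b ≡ suc (a′ + b + k) → a ≡ suc (a′ + k)
  cancel-b a a′ b k eq = +-cancelʳ-≡ b _ _ (trans eq (swap a′ b k))
    where
    swap : ∀ a b k → 1 + (a + b + k) ≡ 1 + (a + k) + b
    swap = solve-∀

  cancel-a : ∀ a b b′ k → a + b ≡ suc (a + b′ + k) → b ≡ suc (b′ + k)
  cancel-a a b b′ k eq = +-cancelˡ-≡ a _ _ (trans eq (move a b′ k))
    where
    move : ∀ a b k → 1 + (a + b + k) ≡ a + (1 + (b + k))
    move = solve-∀

  +0 : ∀ c {x} r → c + 0 + r ≡ x → c + r ≡ x
  +0 c r = trans (cong (_+ r) (sym (+-identityʳ c)))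

  regroup : ∀ B c b → B + B + (c + b) ≡ B + (B + c) + b
  regroup = solve-∀

  code : GridPoint (suc m ∷ suc n ∷ []) → ℕ
  code (a ∷ b ∷ []) = (toℕ a + toℕ b) * B + toℕ b

  digit<B : (b : Fin (suc n)) → toℕ b < B
  digit<B b = m<n⇒m<1+n (Fin.toℕ<n b)

  code-max : ∀ (a : Fin (suc m)) (b : Fin (suc n)) → (toℕ a + toℕ b) * B + toℕ b ≤ (m + n) * B + n
  code-max a b = +-mono-≤ (*-monoˡ-≤ B (+-mono-≤ (Fin.toℕ≤pred[n] a) (Fin.toℕ≤pred[n] b)))
                          (Fin.toℕ≤pred[n] b)

  code-top : ∀ a b → code (a ∷ b ∷ []) ≤ code (Fin.fromℕ m ∷ Fin.fromℕ n ∷ [])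
  code-top a b rewrite Fin.toℕ-fromℕ m | Fin.toℕ-fromℕ n = code-max a b

  code-bound : ∀ a b → code (a ∷ b ∷ []) < 2 + B + (m + n) * B + n
  code-bound a b = begin-strict
    code (a ∷ b ∷ [])        ≤⟨ code-max a b ⟩
    (m + n) * B + n          <⟨ n<1+n _ ⟩
    1 + ((m + n) * B + n)    ≤⟨ +-monoˡ-≤ ((m + n) * B + n) {1} {2 + B} (s≤s z≤n) ⟩
    2 + B + ((m + n) * B + n) ≡⟨ +-assoc (2 + B) ((m + n) * B) n ⟨
    2 + B + (m + n) * B + n  ∎

  inj : ∀ {u v} → code u ≡ code v → u ≡ v
  inj {a ∷ b ∷ []} {a′ ∷ b′ ∷ []} eq
    with digits-injective (toℕ a + toℕ b) (toℕ a′ + toℕ b′) (digit<B b) (digit<B b′) eq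
  ... | a+b≡ , b≡ with Fin.toℕ-injective b≡
  ... | refl = cong (_∷ _) (Fin.toℕ-injective (+-cancelʳ-≡ (toℕ b) _ _ a+b≡))

  split : ∀ a b a′ b′ δ → code (a ∷ b ∷ []) ≡ δ + code (a′ ∷ b′ ∷ []) →
          (toℕ a + toℕ b ≡ toℕ a′ + toℕ b′ × toℕ b ≡ δ + toℕ b′) ⊎
          (∃[ k ] toℕ a + toℕ b ≡ suc (toℕ a′ + toℕ b′ + k) × suc k * B + toℕ b ≡ δ + toℕ b′)
  split a b a′ b′ δ = digit-gap (toℕ a + toℕ b) (toℕ a′ + toℕ b′) (toℕ b′) δ (digit<B b)

  Gap : ℕ → Set
  Gap δ = ∃ λ (_ : Fin 1) → B ≤ δ × δ ≤ suc B

  to : ∀ u v δ → code u ≡ δ + code v → GridAdj u v → Gap δ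
  to (a ∷ b ∷ []) (a′ ∷ b′ ∷ []) δ eq adj with split a b a′ b′ δ eq | gridAdj-∷⁻ adj
  ... | inj₁ (a+b≡ , _) | inj₁ (gap , refl) =
    contradiction (+-cancelʳ-≡ (toℕ b) _ _ a+b≡) (∣-∣≡1⇒≢ (toℕ a) (toℕ a′) gap)
  -- A step in `a` raises the digit sum by one and keeps the last digit, so δ = B.
  ... | inj₂ (k , a+b≡ , δ≡) | inj₁ (gap , refl)
    with refl ← ∣-∣≡1∧m≡1+n+k⇒k≡0 (toℕ a) (toℕ a′) gap
                  (cancel-b (toℕ a) (toℕ a′) (toℕ b) k a+b≡)
    with refl ← +-cancelʳ-≡ (toℕ b) B δ (+0 B (toℕ b) δ≡) =
    zero , ≤-refl , n≤1+n B
  ... | same-or-gap | inj₂ (refl , adj′) with gridAdj-∷⁻ adj′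
  ...   | inj₂ (_ , () , _)
  ...   | inj₁ (gap , _) with same-or-gap
  ...     | inj₁ (a+b≡ , _) =
    contradiction (+-cancelˡ-≡ (toℕ a) _ _ a+b≡) (∣-∣≡1⇒≢ (toℕ b) (toℕ b′) gap)
  -- A step in `b` raises both the digit sum and the last digit by one, so δ = B + 1.
  ...     | inj₂ (k , a+b≡ , δ≡)
    with b≡ ← cancel-a (toℕ a) (toℕ b) (toℕ b′) k a+b≡
    with refl ← ∣-∣≡1∧m≡1+n+k⇒k≡0 (toℕ b) (toℕ b′) gap b≡
    with refl ← +-cancelʳ-≡ (toℕ b′) (suc B) δ (begin-equality
                  suc B + toℕ b′            ≡⟨ +-suc B (toℕ b′) ⟨
                  B + suc (toℕ b′)          ≡⟨ cong (λ r → B + suc r) (+-identityʳ (toℕ b′)) ⟨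
                  B + suc (toℕ b′ + 0)      ≡⟨ cong (B +_) b≡ ⟨
                  B + toℕ b                 ≡⟨ +0 B (toℕ b) δ≡ ⟩
                  δ + toℕ b′                ∎) =
    zero , n≤1+n B , ≤-refl

  from : ∀ u v δ → code u ≡ δ + code v → Gap δ → GridAdj u v
  from (a ∷ b ∷ []) (a′ ∷ b′ ∷ []) δ eq (_ , B≤δ , δ≤1+B) with split a b a′ b′ δ eq
  ... | inj₁ (_ , b≡) = contradiction (digit<B b) (≤⇒≯ (begin
    B             ≤⟨ B≤δ ⟩
    δ             ≤⟨ m≤m+n δ (toℕ b′) ⟩
    δ + toℕ b′    ≡⟨ b≡ ⟨
    toℕ b         ∎))
  -- A digit sum higher by at least two gives δ ≥ 2B - n = B + 2.
  ... | inj₂ (suc k , _ , δ≡) = contradiction (≤-reflexive δ≡) (<⇒≱ (begin-strict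
    δ + toℕ b′                ≤⟨ +-mono-≤ δ≤1+B (Fin.toℕ≤pred[n] b′) ⟩
    suc B + n                 <⟨ n<1+n (suc B + n) ⟩
    suc (suc B + n)           ≡⟨ cong suc (+-suc B n) ⟨
    suc (B + suc n)           ≡⟨ +-suc B (suc n) ⟨
    B + B                     ≤⟨ m≤m+n (B + B) (k * B + toℕ b) ⟩
    B + B + (k * B + toℕ b)   ≡⟨ regroup B (k * B) (toℕ b) ⟩
    B + (B + k * B) + toℕ b   ∎))
  ... | inj₂ (zero , a+b≡ , δ≡) with m≤n⇒m<n∨m≡n B≤δ
  -- The digit sum has risen by exactly one. If δ = B, then `b` is unchanged and `a` made the step;
  -- if δ = B + 1, then `b` made it and `a` is unchanged.
  ...   | inj₂ refl
    with refl ← Fin.toℕ-injective (+-cancelˡ-≡ B (toℕ b) (toℕ b′) (+0 B (toℕ b) δ≡)) =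
    gridAdj-here (∣suc-∣≡1 (toℕ a) (toℕ a′)
      (trans (cancel-b (toℕ a) (toℕ a′) (toℕ b) 0 a+b≡) (cong suc (+-identityʳ _))))
  ...   | inj₁ B<δ
    with refl ← ≤-antisym δ≤1+B B<δ
    with b≡ ← +-cancelˡ-≡ B (toℕ b) (suc (toℕ b′))
                (trans (+0 B (toℕ b) δ≡) (sym (+-suc B (toℕ b′))))
    with refl ← Fin.toℕ-injective {i = a} {a′} (+-cancelʳ-≡ (toℕ b) _ _ (begin-equality
                  toℕ a + toℕ b                ≡⟨ a+b≡ ⟩
                  suc (toℕ a′ + toℕ b′ + 0)    ≡⟨ cong suc (+-identityʳ _) ⟩
                  suc (toℕ a′ + toℕ b′)        ≡⟨ +-suc (toℕ a′) (toℕ b′) ⟨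
                  toℕ a′ + suc (toℕ b′)        ≡⟨ cong (toℕ a′ +_) b≡ ⟨
                  toℕ a′ + toℕ b               ∎)) =
    gridAdj-there (gridAdj-here (∣suc-∣≡1 (toℕ b) (toℕ b′) b≡))

-- The new coordinate is scaled beyond twice the old codes, so that a change in
-- it produces a gap above all old intervals, equal to the scale exactly when
-- the coordinate changes by one and the others agree.
extendCode : ∀ {k d} n {ns : Vec ℕ d} → GridCode k ns → GridCode (suc k) (suc n ∷ ns)
extendCode {k} n {ns} C = record
  { code           = code
  ; code-injective = inj
  ; bottom         = zero ∷ C.bottom
  ; top            = Fin.fromℕ n ∷ C.top
  ; code-bottom    = C.code-bottom
  ; code≤top       = λ { (x ∷ xs) → code-top x xs }
  ; lo             = lo
  ; hi             = hi
  ; lo≤hi          = λ { zero → ≤-refl ; (suc j) → C.lo≤hi j }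
  ; separated      = sep
  ; bound          = suc (suc n * S)
  ; code<bound     = λ { (x ∷ xs) → code-bound x xs }
  ; hi<bound       = λ { zero    → s≤s (m≤m+n S (n * S))
                         ; (suc j) → s≤s (≤-trans (<⇒≤ (hi<S j)) (m≤m+n S (n * S))) }
  ; adj⇔gap        = λ { u@(_ ∷ _) v@(_ ∷ _) δ eq → mk⇔ (to u v δ eq) (from u v δ eq) }
  }
  where
  open ≤-Reasoning
  module C = GridCode C
  S = C.bound + C.bound

  code : GridPoint (suc n ∷ ns) → ℕ
  code (x ∷ xs) = toℕ x * S + C.code xs

  lo hi : Fin (suc k) → ℕ
  lo zero    = S
  lo (suc j) = C.lo j
  hi zero    = S
  hi (suc j) = C.hi j

  code<S : ∀ xs → C.code xs < S
  code<S xs = m≤n⇒m≤n+o C.bound (C.code<bound xs)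

  hi<S : ∀ j → C.hi j < S
  hi<S j = m≤n⇒m≤n+o C.bound (C.hi<bound j)

  code-top : ∀ x xs → code (x ∷ xs) ≤ code (Fin.fromℕ n ∷ C.top)
  code-top x xs rewrite Fin.toℕ-fromℕ n = +-mono-≤ (*-monoˡ-≤ S (Fin.toℕ≤pred[n] x)) (C.code≤top xs)

  code-bound : ∀ x xs → code (x ∷ xs) < suc (suc n * S)
  code-bound x xs = s≤s (begin
    toℕ x * S + C.code xs  ≤⟨ +-mono-≤ (*-monoˡ-≤ S (Fin.toℕ≤pred[n] x)) (<⇒≤ (code<S xs)) ⟩
    n * S + S              ≡⟨ +-comm (n * S) S ⟩
    suc n * S              ∎)

  sep : ∀ i j → i ≢ j → hi i < lo j ⊎ hi j < lo i
  sep zero    zero    i≢j = contradiction refl i≢j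
  sep zero    (suc j) _   = inj₂ (hi<S j)
  sep (suc i) zero    _   = inj₁ (hi<S i)
  sep (suc i) (suc j) i≢j = C.separated i j (λ eq → i≢j (cong suc eq))

  inj : ∀ {u v} → code u ≡ code v → u ≡ v
  inj {x ∷ xs} {y ∷ ys} eq with digits-injective (toℕ x) (toℕ y) (code<S xs) (code<S ys) eq
  ... | x≡ , xs≡ = cong₂ _∷_ (Fin.toℕ-injective x≡) (C.code-injective xs≡)

  to : ∀ u v δ → code u ≡ δ + code v → GridAdj u v → ∃[ j ] lo j ≤ δ × δ ≤ hi j
  to (x ∷ xs) (y ∷ ys) δ eq adj
    with digit-gap (toℕ x) (toℕ y) (C.code ys) δ (code<S xs) eq | gridAdj-∷⁻ adj
  ... | inj₁ (x≡ , _)  | inj₁ (gap , _) = contradiction x≡ (∣-∣≡1⇒≢ (toℕ x) (toℕ y) gap)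
  ... | inj₁ (_ , xs≡) | inj₂ (_ , adj′) with Equivalence.to (C.adj⇔gap xs ys δ xs≡) adj′
  ...   | j , p = suc j , p
  to (x ∷ xs) (y ∷ ys) δ eq adj | inj₂ (k , x≡ , δ≡) | inj₁ (gap , refl)
    with refl ← ∣-∣≡1∧m≡1+n+k⇒k≡0 (toℕ x) (toℕ y) {k} gap x≡
    with refl ← +-cancelʳ-≡ (C.code xs) _ _ δ≡ =
    zero , m≤m+n S 0 , ≤-reflexive (+-identityʳ S)
  to (x ∷ xs) (y ∷ ys) δ eq adj | inj₂ (k , x≡ , δ≡) | inj₂ (refl , _) =
    contradiction x≡ (<⇒≢ (s≤s (m≤m+n (toℕ x) k)))

  from : ∀ u v δ → code u ≡ δ + code v → ∃[ j ] lo j ≤ δ × δ ≤ hi j → GridAdj u v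
  from (x ∷ xs) (y ∷ ys) δ eq (j , lo≤δ , δ≤hi)
    with digit-gap (toℕ x) (toℕ y) (C.code ys) δ (code<S xs) eq
  from (x ∷ xs) (y ∷ ys) δ eq (zero , S≤δ , _) | inj₁ (_ , xs≡) =
    contradiction (code<S xs) (≤⇒≯ (begin
    S              ≤⟨ S≤δ ⟩
    δ              ≤⟨ m≤m+n δ (C.code ys) ⟩
    δ + C.code ys  ≡⟨ xs≡ ⟨
    C.code xs      ∎))
  from (x ∷ xs) (y ∷ ys) δ eq (suc j , p) | inj₁ (x≡ , xs≡)
    with refl ← Fin.toℕ-injective {i = x} {y} x≡ =
    gridAdj-there (Equivalence.from (C.adj⇔gap xs ys δ xs≡) (j , p))
  -- A gap in an old interval is below `C.bound`, and so is the code of `ys`. Their sum stays below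
  -- S, too small to make up for a change of the first coordinate.
  from (x ∷ xs) (y ∷ ys) δ eq (suc j , _ , δ≤hi) | inj₂ (k , _ , δ≡) =
    contradiction (≤-reflexive δ≡) (<⇒≱ (begin-strict
    δ + C.code ys              <⟨ +-mono-< (≤-<-trans δ≤hi (C.hi<bound j)) (C.code<bound ys) ⟩
    S                          ≤⟨ m≤m+n S (k * S) ⟩
    suc k * S                  ≤⟨ m≤m+n (suc k * S) (C.code xs) ⟩
    suc k * S + C.code xs      ∎))
  -- Here δ = S. Cancelling S leaves `k * S + C.code xs` equal to a code below S, so k = 0, and
  -- injectivity of the old code identifies the tails.
  from (x ∷ xs) (y ∷ ys) δ eq (zero , S≤δ , δ≤S) | inj₂ (k , x≡ , δ≡) with refl ← ≤-antisym δ≤S S≤δ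
    with +-cancelˡ-≡ S _ _ (trans (sym (+-assoc S (k * S) (C.code xs))) δ≡)
  from (x ∷ xs) (y ∷ ys) δ eq _ | inj₂ (zero , x≡ , _) | xs≡
    with refl ← C.code-injective {xs} {ys} xs≡ =
    gridAdj-here (∣suc-∣≡1 (toℕ x) (toℕ y) (trans x≡ (cong suc (+-identityʳ _))))
  from (x ∷ xs) (y ∷ ys) δ eq _ | inj₂ (suc k , _ , _) | ys≡ = contradiction (code<S ys) (≤⇒≯ (begin
    S                          ≤⟨ m≤m+n S (k * S) ⟩
    suc k * S                  ≤⟨ m≤m+n (suc k * S) (C.code xs) ⟩
    suc k * S + C.code xs      ≡⟨ ys≡ ⟩
    C.code ys                  ∎))

-- The plane needs one interval for two coordinates and every further coordinate adds one interval,
-- so the saving of one persists in all dimensions.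
gridCode : ∀ k (ns : Vec ℕ (2 + k)) → All (1 ≤_) ns → GridCode (suc k) ns
gridCode zero    (suc m ∷ suc n ∷ []) (s≤s _ ∷ s≤s _ ∷ []) = planeCode m n
gridCode (suc k) (suc n ∷ ns)         (s≤s _ ∷ ns≥1)         = extendCode n (gridCode k ns ns≥1)

-- Natural numbers among the reals, and intervals between them

-- Iterated addition of `1ℚ` is the shape in which `walkWeight` sums unit weights.
fromℕ : ℕ → ℚ
fromℕ zero    = 0ℚ
fromℕ (suc n) = 1ℚ ℚ.+ fromℕ n

fromℕ-nonNeg : ∀ n → 0ℚ ℚ.≤ fromℕ n
fromℕ-nonNeg zero    = ℚ.≤-refl
fromℕ-nonNeg (suc n) = ℚ.+-mono-≤ {0ℚ} {1ℚ} {0ℚ} (from-yes (0ℚ ℚ.≤? 1ℚ)) (fromℕ-nonNeg n)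

fromℕ-mono-≤ : ∀ {m n} → m ≤ n → fromℕ m ℚ.≤ fromℕ n
fromℕ-mono-≤ {n = n} z≤n = fromℕ-nonNeg n
fromℕ-mono-≤ (s≤s m≤n)   = ℚ.+-monoʳ-≤ 1ℚ (fromℕ-mono-≤ m≤n)

-- Distinct naturals are at least 1 apart, so an error below 1 cannot reverse their order. This lets
-- a single term of a real sequence decide comparisons of naturals.
fromℕ-cancel-≤ : ∀ m n {q} → q ℚ.< 1ℚ → fromℕ m ℚ.≤ fromℕ n ℚ.+ q → m ≤ n
fromℕ-cancel-≤ zero    n       q<1 le = z≤n
fromℕ-cancel-≤ (suc m) zero {q} q<1 le = contradiction (begin-strict
  1ℚ ℚ.+ 0ℚ       ≤⟨ ℚ.+-monoʳ-≤ 1ℚ (fromℕ-nonNeg m) ⟩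
  1ℚ ℚ.+ fromℕ m  ≤⟨ le ⟩
  0ℚ ℚ.+ q        ≡⟨ ℚ.+-identityˡ q ⟩
  q               <⟨ q<1 ⟩
  1ℚ ℚ.+ 0ℚ       ∎) (ℚ.<-irrefl refl)
  where open ℚ.≤-Reasoning
fromℕ-cancel-≤ (suc m) (suc n) {q} q<1 le =
  s≤s (fromℕ-cancel-≤ m n q<1 (begin
    fromℕ m                                    ≡⟨ cancel (fromℕ m) ⟨
    ℚ.- 1ℚ ℚ.+ (1ℚ ℚ.+ fromℕ m)                ≤⟨ ℚ.+-monoʳ-≤ (ℚ.- 1ℚ) le ⟩
    ℚ.- 1ℚ ℚ.+ ((1ℚ ℚ.+ fromℕ n) ℚ.+ q)        ≡⟨ cong (ℚ.- 1ℚ ℚ.+_) (ℚ.+-assoc 1ℚ (fromℕ n) q) ⟩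
    ℚ.- 1ℚ ℚ.+ (1ℚ ℚ.+ (fromℕ n ℚ.+ q))        ≡⟨ cancel (fromℕ n ℚ.+ q) ⟩
    fromℕ n ℚ.+ q                              ∎))
  where
  open ℚ.≤-Reasoning
  cancel : ∀ p → ℚ.- 1ℚ ℚ.+ (1ℚ ℚ.+ p) ≡ p
  cancel p = trans (sym (ℚ.+-assoc (ℚ.- 1ℚ) 1ℚ p)) (ℚ.+-identityˡ p)

2/suc-nonNeg : ∀ n → 0ℚ ℚ.≤ 2/suc n
2/suc-nonNeg n = ℚ.nonNegative⁻¹ (2/suc n) {{ℚ.normalize-nonNeg 2 (suc n)}}

-- Stronger than x ≃ᴿ fromℚ (fromℕ n); it holds of all sums of the constant
-- sequence 1ℚ.
IsNat : ℝ → ℕ → Set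
IsNat x n = ∀ k → seq x k ≡ fromℕ n

≤ᴿ⇔≤ : ∀ x y m n → IsNat x m → IsNat y n → x ≤ᴿ y ⇔ m ≤ n
≤ᴿ⇔≤ x y m n x≡m y≡n = mk⇔
  -- Index 2 is the first whose tolerance, 2/3, is below 1.
  (λ x≤y → fromℕ-cancel-≤ m n (from-yes (2/suc 2 ℚ.<? 1ℚ))
             (subst₂ (λ p q → p ℚ.≤ q ℚ.+ 2/suc 2) (x≡m 2) (y≡n 2) (x≤y 2)))
  (λ m≤n k → subst₂ (λ p q → p ℚ.≤ q ℚ.+ 2/suc k) (sym (x≡m k)) (sym (y≡n k))
     (subst (ℚ._≤ fromℕ n ℚ.+ 2/suc k) (ℚ.+-identityʳ (fromℕ m))
       (ℚ.+-mono-≤ (fromℕ-mono-≤ m≤n) (2/suc-nonNeg k))))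

-- The real r is arbitrary, so both comparisons cost a tolerance; at index 4 they add up to 4/5 < 1.
-- It is used to show that no real lies in two of the intervals.
≤ᴿ-through : ∀ r m n → fromℚ (fromℕ m) ≤ᴿ r → r ≤ᴿ fromℚ (fromℕ n) → m ≤ n
≤ᴿ-through r m n m≤r r≤n = fromℕ-cancel-≤ m n (from-yes (2/suc 4 ℚ.+ 2/suc 4 ℚ.<? 1ℚ)) (begin
  fromℕ m                             ≤⟨ m≤r 4 ⟩
  seq r 4 ℚ.+ 2/suc 4                 ≤⟨ ℚ.+-monoˡ-≤ (2/suc 4) (r≤n 4) ⟩
  (fromℕ n ℚ.+ 2/suc 4) ℚ.+ 2/suc 4   ≡⟨ ℚ.+-assoc (fromℕ n) (2/suc 4) (2/suc 4) ⟩
  fromℕ n ℚ.+ (2/suc 4 ℚ.+ 2/suc 4)   ∎)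
  where open ℚ.≤-Reasoning

natInterval : ∀ {m n} → m ≤ n → ClosedInterval
natInterval {m} {n} m≤n = record
  { lo    = fromℚ (fromℕ m)
  ; hi    = fromℚ (fromℕ n)
  ; lo≤hi = Equivalence.from
              (≤ᴿ⇔≤ (fromℚ (fromℕ m)) (fromℚ (fromℕ n)) m n (λ _ → refl) (λ _ → refl)) m≤n
  }

∈-natInterval : ∀ r {k m n} (m≤n : m ≤ n) → IsNat r k → r ∈ᴵ natInterval m≤n ⇔ (m ≤ k × k ≤ n)
∈-natInterval r {k} {m} {n} m≤n r≡k = mk⇔
  (λ (p , q) → L.to p , R.to q)
  (λ (p , q) → L.from p , R.from q)
  where
  module L = Equivalence (≤ᴿ⇔≤ (fromℚ (fromℕ m)) r m k (λ _ → refl) r≡k)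
  module R = Equivalence (≤ᴿ⇔≤ r (fromℚ (fromℕ n)) k n r≡k (λ _ → refl))

-- Paths from descending functions, and acyclicity from bridges

module _ (G : Graph) where
  open Graph G

  steps : ∀ {x y} → Walk x y → ℕ
  steps ε       = 0
  steps (_ ◅ p) = suc (steps p)

  -- Along a walk on which f drops by one at each step no vertex repeats.
  descent : ∀ {y} (f : V → ℕ) → f y ≡ 0 →
            (∀ x → x ≡ y ⊎ ∃[ z ] Adj x z × f x ≡ suc (f z)) →
            ∀ x → Σ (Path x y) λ (p , _) → steps p ≡ f x
  descent {y} f fy≡0 next x with go (f x) x refl
    where
    -- The bound on f over the vertices of the walk is carried along because it separates a newly
    -- prepended vertex, where f is `suc n`, from all the others.
    go : ∀ n x → f x ≡ n → Σ (Walk x y) λ p →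
         Unique (vertices p) × ListAll.All (λ v → f v ≤ n) (vertices p) × steps p ≡ n
    go n       x eq with next x
    go n       x eq | inj₁ refl = ε , [] ∷ [] , ≤-reflexive eq ∷ [] , trans (sym fy≡0) eq
    go zero    x eq | inj₂ (z , _ , drop) = contradiction (trans (sym eq) drop) 0≢1+n
    go (suc n) x eq | inj₂ (z , xz , drop)
      with go n z (suc-injective (trans (sym drop) eq))
    ... | p , uniq , small , len =
      xz ◅ p ,
      ListAll.map (λ fv≤n x≡v → <⇒≢ (s≤s fv≤n) (trans (cong f (sym x≡v)) eq)) small ∷ uniq ,
      ≤-reflexive eq ∷ ListAll.map m≤n⇒m≤1+n small ,
      cong suc len
  ... | p , uniq , _ , len = (p , uniq) , len

  end-∈ : ∀ {x y} {P : V → Set} (p : Walk x y) → ListAll.All P (vertices p) → P y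
  end-∈ ε       (px ∷ _) = px
  end-∈ (_ ◅ p) (_ ∷ ps) = end-∈ p ps

  -- The condition says that xz is a bridge, with S containing the component of
  -- z after its removal.
  acyclic-by-bridges :
    (∀ {x z} → Adj x z → Σ (V → Set) λ S → S z ×
       (∀ {u v} → Adj u v → S u → v ≢ x → S v) ×
       (∀ {y} → S y → Adj y x → y ≡ z)) →
    Acyclic
  acyclic-by-bridges bridge (ε , _)          (s≤s ()) yx
  acyclic-by-bridges bridge (_ ◅ ε , _)      (s≤s (s≤s ())) yx
  acyclic-by-bridges bridge {x} {y} (_◅_ {j = z} xz p@(_ ◅ q) , x∉p ∷ z∉q ∷ _) _ yx
    with bridge xz
  -- The path after x starts at z and avoids x, so it stays in S and its end y is in S. Being
  -- adjacent to x, y must be z, yet z does not recur on the path.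
  ... | S , Sz , closed , exit = end-∈ q z∉q (sym (exit (spread p Sz x∉p) yx))
    where
    spread : ∀ {u w} (p : Walk u w) → S u → ListAll.All (x ≢_) (vertices p) → S w
    spread ε              Su _ = Su
    spread (uv ◅ ε)       Su (_ ∷ x≢v ∷ _) = closed uv Su (≢-sym x≢v)
    spread (uv ◅ p@(_ ◅ _)) Su (_ ∷ x∉@(x≢v ∷ _)) = spread p (closed uv Su (≢-sym x≢v)) x∉

-- The caterpillar tree, its distances and its leaves

-- A caterpillar: each a : A is a leaf hung at position pos a of the spine
-- 0 , … , h.
module Caterpillar
  (A : Set) (finite : ∃[ m ] (A ↔ Fin m))
  (h : ℕ) (0<h : 0 < h)
  (pos : A → ℕ) (pos≤h : ∀ a → pos a ≤ h)
  (first last : A) (pos-first : pos first ≡ 0) (pos-last : pos last ≡ h)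
  where

  _≟ᴬ_ : DecidableEquality A
  _≟ᴬ_ = via-injection (↔⇒↣ (proj₂ finite)) Fin._≟_

  Vertex : Set
  Vertex = Fin (suc h) ⊎ A

  infix 4 _~_

  _~_ : Vertex → Vertex → Set
  inj₁ i ~ inj₁ j = suc (toℕ i) ≡ toℕ j ⊎ suc (toℕ j) ≡ toℕ i
  inj₁ i ~ inj₂ a = toℕ i ≡ pos a
  inj₂ a ~ inj₁ i = toℕ i ≡ pos a
  inj₂ _ ~ inj₂ _ = ⊥

  ~? : Decidable _~_
  ~? (inj₁ i) (inj₁ j) = (suc (toℕ i) ≟ toℕ j) ⊎-dec (suc (toℕ j) ≟ toℕ i)
  ~? (inj₁ i) (inj₂ a) = toℕ i ≟ pos a
  ~? (inj₂ a) (inj₁ i) = toℕ i ≟ pos a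
  ~? (inj₂ _) (inj₂ _) = no λ ()

  ~-sym : Symmetric _~_
  ~-sym {inj₁ i} {inj₁ j} (inj₁ e) = inj₂ e
  ~-sym {inj₁ i} {inj₁ j} (inj₂ e) = inj₁ e
  ~-sym {inj₁ i} {inj₂ a} e = e
  ~-sym {inj₂ a} {inj₁ i} e = e

  ~-irrefl : Irreflexive _≡_ _~_
  ~-irrefl {inj₁ i} refl (inj₁ e) = 1+n≢n e
  ~-irrefl {inj₁ i} refl (inj₂ e) = 1+n≢n e
  ~-irrefl {inj₂ a} refl ()

  caterpillar : Graph
  caterpillar = record
    { V        = Vertex
    ; finite   = _ , ↔-sym Fin.+↔⊎ ↔-∘ (↔-id (Fin (suc h)) ⊎-↔ proj₂ finite)
    ; nonempty = inj₁ zero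
    ; Adj      = _~_
    ; adj?     = ~?
    ; adj-sym  = λ {x} {y} → ~-sym {x} {y}
    ; irrefl   = ~-irrefl
    }

  open Graph caterpillar using (Leaf; Acyclic)

  spine : ∀ {n} → n ≤ h → Fin (suc h)
  spine n≤h = fromℕ< (s≤s n≤h)

  toℕ-spine : ∀ {n} (n≤h : n ≤ h) → toℕ (spine n≤h) ≡ n
  toℕ-spine n≤h = Fin.toℕ-fromℕ< (s≤s n≤h)

  position : Vertex → ℕ
  position (inj₁ i) = toℕ i
  position (inj₂ a) = pos a

  acyclic : Acyclic
  acyclic = acyclic-by-bridges caterpillar λ {x} {z} → bridge {x} {z}
    where
    bridge : ∀ {x z} → x ~ z → Σ (Vertex → Set) λ S → S z ×
             (∀ {u v} → u ~ v → S u → v ≢ x → S v) × (∀ {y} → S y → y ~ x → y ≡ z)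
    -- For an upward spine edge, S is everything positioned beyond i. A step out of S would have to
    -- land on the spine vertex i, which is excluded. The downward case is the mirror image.
    bridge {inj₁ i} {inj₁ j} (inj₁ si≡j) =
      (λ v → toℕ i < position v) , ≤-reflexive si≡j ,
      (λ {u} {v} → closed {u} {v}) , λ {y} → exit {y}
      where
      closed : ∀ {u v} → u ~ v → toℕ i < position u → v ≢ inj₁ i → toℕ i < position v
      closed {inj₁ k} {inj₁ l} (inj₁ e) i<k _ = <-trans i<k (≤-reflexive e)
      closed {inj₁ k} {inj₁ l} (inj₂ e) i<k v≢i =
        ≤∧≢⇒< (≤-pred (≤-trans i<k (≤-reflexive (sym e))))
              (λ eq → v≢i (cong inj₁ (Fin.toℕ-injective (sym eq))))
      closed {inj₁ k} {inj₂ a} e i<k _ = subst (toℕ i <_) e i<k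
      closed {inj₂ a} {inj₁ k} e i<k _ = subst (toℕ i <_) (sym e) i<k
      exit : ∀ {y} → toℕ i < position y → y ~ inj₁ i → y ≡ inj₁ j
      exit {inj₁ k} i<k (inj₁ e) = contradiction (≤-trans (n≤1+n _) (≤-reflexive e)) (<⇒≱ i<k)
      exit {inj₁ k} i<k (inj₂ e) = cong inj₁ (Fin.toℕ-injective (trans (sym e) si≡j))
      exit {inj₂ a} i<k e        = contradiction e (<⇒≢ i<k)
    bridge {inj₁ i} {inj₁ j} (inj₂ sj≡i) =
      (λ v → position v < toℕ i) , ≤-reflexive sj≡i ,
      (λ {u} {v} → closed {u} {v}) , λ {y} → exit {y}
      where
      closed : ∀ {u v} → u ~ v → position u < toℕ i → v ≢ inj₁ i → position v < toℕ i
      closed {inj₁ k} {inj₁ l} (inj₂ e) k<i _ = <-trans (≤-reflexive e) k<i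
      closed {inj₁ k} {inj₁ l} (inj₁ e) k<i v≢i =
        ≤∧≢⇒< (≤-trans (≤-reflexive (sym e)) k<i) (λ eq → v≢i (cong inj₁ (Fin.toℕ-injective eq)))
      closed {inj₁ k} {inj₂ a} e k<i _ = subst (_< toℕ i) e k<i
      closed {inj₂ a} {inj₁ k} e k<i _ = subst (_< toℕ i) (sym e) k<i
      exit : ∀ {y} → position y < toℕ i → y ~ inj₁ i → y ≡ inj₁ j
      exit {inj₁ k} k<i (inj₂ e) = contradiction (≤-trans (n≤1+n _) (≤-reflexive e)) (<⇒≱ k<i)
      exit {inj₁ k} k<i (inj₁ e) = cong inj₁ (Fin.toℕ-injective (suc-injective (trans e (sym sj≡i))))
      exit {inj₂ a} k<i e        = contradiction (sym e) (<⇒≢ k<i)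
    bridge {inj₁ i} {inj₂ a} i≡a =
      (_≡ inj₂ a) , refl ,
      (λ { {_} {inj₁ j} j≡a refl v≢i →
             contradiction (cong inj₁ (Fin.toℕ-injective (trans j≡a (sym i≡a)))) v≢i
         ; {_} {inj₂ _} () refl _ }) ,
      λ y≡a _ → y≡a
    -- A leaf has a single neighbour, so S can be the whole vertex set.
    bridge {inj₂ a} {inj₁ i} i≡a =
      (λ _ → ⊤) , tt , (λ _ _ _ → tt) ,
      λ { {inj₁ j} _ j≡a → cong inj₁ (Fin.toℕ-injective (trans j≡a (sym i≡a)))
        ; {inj₂ _} _ () }

  lower : ∀ (i : Fin (suc h)) → toℕ i ≡ 0 ⊎ ∃ λ (j : Fin (suc h)) → suc (toℕ j) ≡ toℕ i
  lower zero    = inj₁ refl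
  lower (suc i) = inj₂ (Fin.inject₁ i , cong suc (Fin.toℕ-inject₁ i))

  upper : ∀ (i : Fin (suc h)) → toℕ i ≡ h ⊎ ∃ λ (j : Fin (suc h)) → suc (toℕ i) ≡ toℕ j
  upper i with m≤n⇒m<n∨m≡n (Fin.toℕ≤pred[n] i)
  ... | inj₁ i<h = inj₂ (spine i<h , sym (toℕ-spine i<h))
  ... | inj₂ i≡h = inj₁ i≡h

  toward : ∀ (i : Fin (suc h)) {t} → t ≤ h → toℕ i ≡ t ⊎
           ∃[ j ] inj₁ i ~ inj₁ j × ∣ toℕ i - t ∣ ≡ suc ∣ toℕ j - t ∣
  toward i {t} t≤h with <-cmp (toℕ i) t | upper i | lower i
  ... | tri≈ _ i≡t _ | _ | _ = inj₁ i≡t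
  ... | tri< i<t _ _ | inj₁ i≡h | _ = contradiction (<-≤-trans i<t t≤h) (<-irrefl i≡h)
  ... | tri< i<t _ _ | inj₂ (j , i+1≡j) | _ = inj₂ (j , inj₁ i+1≡j ,
        trans (∣m-n∣≡1+∣1+m-n∣ (toℕ i) t i<t) (cong (λ n → suc ∣ n - t ∣) i+1≡j))
  ... | tri> _ _ t<i | _ | inj₁ i≡0 = contradiction (subst (t <_) i≡0 t<i) n≮0
  ... | tri> _ _ t<i | _ | inj₂ (j , j+1≡i) = inj₂ (j , inj₂ j+1≡i ,
        trans (cong ∣_- t ∣ (sym j+1≡i))
              (∣1+m-n∣≡1+∣m-n∣ (toℕ j) t (≤-pred (subst (t <_) (sym j+1≡i) t<i))))

  -- The graph distance in closed form. Two leaves are compared as labels, since the formula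
  -- `2 + ∣ pos a - pos b ∣` fails for a leaf and itself.
  distance : Vertex → Vertex → ℕ
  distance (inj₁ i) (inj₁ j) = ∣ toℕ i - toℕ j ∣
  distance (inj₁ i) (inj₂ a) = suc ∣ toℕ i - pos a ∣
  distance (inj₂ a) (inj₁ j) = suc ∣ pos a - toℕ j ∣
  distance (inj₂ a) (inj₂ b) with a ≟ᴬ b
  ... | yes _ = 0
  ... | no  _ = 2 + ∣ pos a - pos b ∣

  distance-refl : ∀ y → distance y y ≡ 0
  distance-refl (inj₁ i) = ∣n-n∣≡0 (toℕ i)
  distance-refl (inj₂ a) with a ≟ᴬ a
  ... | yes _  = refl
  ... | no a≢a = contradiction refl a≢a

  distance-leaves : ∀ {a b} → a ≢ b → distance (inj₂ a) (inj₂ b) ≡ 2 + ∣ pos a - pos b ∣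
  distance-leaves {a} {b} a≢b with a ≟ᴬ b
  ... | yes a≡b = contradiction a≡b a≢b
  ... | no _    = refl

  -- The hypothesis of `descent` for the distance to y. From a leaf other than y one steps onto the
  -- spine; on the spine one moves toward the position of y and, once level with it, out to y if y
  -- is a leaf.
  closer : ∀ y x → x ≡ y ⊎ ∃[ z ] x ~ z × distance x y ≡ suc (distance z y)
  closer (inj₁ j) (inj₁ i) with toward i (Fin.toℕ≤pred[n] j)
  ... | inj₁ i≡j          = inj₁ (cong inj₁ (Fin.toℕ-injective i≡j))
  ... | inj₂ (k , ik , d) = inj₂ (inj₁ k , ik , d)
  closer (inj₂ a) (inj₁ i) with toward i (pos≤h a)
  ... | inj₂ (k , ik , d) = inj₂ (inj₁ k , ik , cong suc d)
  ... | inj₁ i≡a          = inj₂ (inj₂ a , i≡a ,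
        cong suc (trans (m≡n⇒∣m-n∣≡0 i≡a) (sym (distance-refl (inj₂ a)))))
  closer (inj₁ j) (inj₂ a) = inj₂ (inj₁ (spine (pos≤h a)) , toℕ-spine (pos≤h a) ,
    cong (λ n → suc ∣ n - toℕ j ∣) (sym (toℕ-spine (pos≤h a))))
  closer (inj₂ b) (inj₂ a) with a ≟ᴬ b
  ... | yes a≡b = inj₁ (cong inj₂ a≡b)
  ... | no  _   = inj₂ (inj₁ (spine (pos≤h a)) , toℕ-spine (pos≤h a) ,
    cong (λ n → 2 + ∣ n - pos b ∣) (sym (toℕ-spine (pos≤h a))))

  geodesic : ∀ x y → Σ (Graph.Path caterpillar x y) λ (p , _) → steps caterpillar p ≡ distance x y
  geodesic x y = descent caterpillar (λ z → distance z y) (distance-refl y) (closer y) x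

  tree : WeightedTree
  tree = record
    { graph      = caterpillar
    ; connected  = λ x y → proj₁ (geodesic x y)
    ; acyclic    = λ {x} {y} → acyclic {x} {y}
    ; weight     = λ _ → fromℚ (fromℕ 1)
    ; weight-sym = λ _ _ → 1≤1 , 1≤1
    ; weight-pos = λ _ → 2 , from-yes (0ℚ ℚ.+ 2/suc 2 ℚ.<? 1ℚ)
    }
    where
    1≤1 : fromℚ (fromℕ 1) ≤ᴿ fromℚ (fromℕ 1)
    1≤1 = Equivalence.from
            (≤ᴿ⇔≤ (fromℚ (fromℕ 1)) (fromℚ (fromℕ 1)) 1 1 (λ _ → refl) (λ _ → refl)) ≤-refl

  open WeightedTree tree using (Walk; walkWeight; dist; L)

  walkWeight-steps : ∀ {x y} (p : Walk x y) → IsNat (walkWeight p) (steps caterpillar p)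
  walkWeight-steps ε       k = refl
  -- Term k of a sum reads its summands at `refine k`, which is why `IsNat` speaks of all indices.
  walkWeight-steps (_ ◅ p) k = cong (1ℚ ℚ.+_) (walkWeight-steps p (refine k))

  -- `dist` follows the path supplied by `connected`, which in `tree` is the geodesic, so its number
  -- of steps is `distance`.
  dist-leaves : ∀ {a b} → a ≢ b → IsNat (dist (inj₂ a) (inj₂ b)) (2 + ∣ pos a - pos b ∣)
  dist-leaves {a} {b} a≢b = subst (IsNat (dist (inj₂ a) (inj₂ b)))
    (trans (proj₂ (geodesic (inj₂ a) (inj₂ b))) (distance-leaves a≢b))
    (walkWeight-steps (proj₁ (proj₁ (geodesic (inj₂ a) (inj₂ b)))))

  leaf : A → L
  leaf a = inj₂ a , inj₁ (inj₁ (spine (pos≤h a)) , toℕ-spine (pos≤h a) ,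
    λ { (inj₁ j) j≡a → cong inj₁ (Fin.toℕ-injective (trans j≡a (sym (toℕ-spine (pos≤h a)))))
      ; (inj₂ _) () })

  inj₁≢inj₂ : ∀ {i a} → _≢_ {A = Vertex} (inj₁ i) (inj₂ a)
  inj₁≢inj₂ ()

  -- Every spine vertex has two distinct neighbours: an inner one has two on the spine, and an end
  -- has one on the spine and the leaf `first` or `last`. The hypothesis 0 < h keeps the two ends
  -- apart.
  spine-not-leaf : ∀ {i} → ¬ Leaf (inj₁ i)
  spine-not-leaf (inj₂ only) = inj₁≢inj₂ (sym (only (inj₂ first)))
  spine-not-leaf {i} (inj₁ (y , _ , unique)) with lower i | upper i
  ... | inj₁ i≡0 | inj₁ i≡h = <⇒≢ 0<h (trans (sym i≡0) i≡h)
  ... | inj₁ i≡0 | inj₂ (k , i+1≡k) =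
    inj₁≢inj₂ (trans (unique (inj₁ k) (inj₁ i+1≡k))
                     (sym (unique (inj₂ first) (trans i≡0 (sym pos-first)))))
  ... | inj₂ (j , j+1≡i) | inj₁ i≡h =
    inj₁≢inj₂ (trans (unique (inj₁ j) (inj₂ j+1≡i))
                     (sym (unique (inj₂ last) (trans i≡h (sym pos-last)))))
  ... | inj₂ (j , j+1≡i) | inj₂ (k , i+1≡k) =
    <⇒≢ (m<n⇒m<1+n (n<1+n (toℕ j))) (begin
      toℕ j              ≡⟨ cong position (unique (inj₁ j) (inj₂ j+1≡i)) ⟩
      position y         ≡⟨ cong position (unique (inj₁ k) (inj₁ i+1≡k)) ⟨
      toℕ k              ≡⟨ i+1≡k ⟨
      suc (toℕ i)        ≡⟨ cong suc j+1≡i ⟨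
      suc (suc (toℕ j))  ∎)
    where open ≡-Reasoning

  leaf-bijective : Bijective _≡_ (_≡_ on proj₁) leaf
  leaf-bijective = inj₂-injective , surjective
    where
    surjective : Surjective _≡_ (_≡_ on proj₁) leaf
    surjective (inj₁ i , isLeaf) = contradiction isLeaf spine-not-leaf
    surjective (inj₂ a , _)      = a , λ { refl → refl }

-- From a code to an interval representation

-- For the grid with a single point. A caterpillar with one spine vertex and one leg would have two
-- leaves.
one-vertex : WeightedTree
one-vertex = record
  { graph      = record
    { V        = ⊤
    ; finite   = 1 , mk↔ₛ′ (λ _ → zero) (λ _ → tt) (λ { zero → refl }) (λ _ → refl)
    ; nonempty = tt
    ; Adj      = λ _ _ → ⊥
    ; adj?     = λ _ _ → no λ ()
    ; adj-sym  = λ ()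
    ; irrefl   = λ _ ()
    }
  ; connected  = λ _ _ → ε , [] ∷ []
  ; acyclic    = λ _ _ ()
  ; weight     = λ ()
  ; weight-sym = λ ()
  ; weight-pos = λ ()
  }

module _ {k d} {ns : Vec ℕ d} (ns≥1 : All (1 ≤_) ns) (1≤k : 1 ≤ k) (C : GridCode k ns) where
  open GridCode C

  gap : GridPoint ns → GridPoint ns → ℕ
  gap u v = ∣ code u - code v ∣

  -- `adj⇔gap` wants the larger code first; symmetry of adjacency gives the other order.
  adj⇔∣gap∣ : ∀ u v → GridAdj u v ⇔ (∃[ j ] lo j ≤ gap u v × gap u v ≤ hi j)
  adj⇔∣gap∣ u v with ≤-total (code v) (code u)
  ... | inj₁ v≤u rewrite m≤n⇒∣n-m∣≡n∸m v≤u = adj⇔gap u v _ (sym (m∸n+n≡m v≤u))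
  ... | inj₂ u≤v rewrite m≤n⇒∣m-n∣≡n∸m u≤v =
    mk⇔ (λ uv → to (adj-sym {u} {v} uv)) (λ p → adj-sym {v} {u} (from p))
    where
    open Equivalence (adj⇔gap v u _ (sym (m∸n+n≡m u≤v)))
    open Graph (grid ns ns≥1) using (adj-sym)

  interval : Fin k → ClosedInterval
  -- The shift by 2 accounts for the two edges that join the leaves to the spine.
  interval j = natInterval (+-monoʳ-≤ 2 (lo≤hi j))

  intervals-disjoint : ∀ i j → i ≢ j → ∀ r → ¬ (r ∈ᴵ interval i × r ∈ᴵ interval j)
  intervals-disjoint i j i≢j r ((loᵢ≤r , r≤hiᵢ) , (loⱼ≤r , r≤hiⱼ)) with separated i j i≢j
  ... | inj₁ hiᵢ<loⱼ = <⇒≱ (+-monoʳ-< 2 hiᵢ<loⱼ) (≤ᴿ-through r (2 + lo j) (2 + hi i) loⱼ≤r r≤hiᵢ)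
  ... | inj₂ hiⱼ<loᵢ = <⇒≱ (+-monoʳ-< 2 hiⱼ<loᵢ) (≤ᴿ-through r (2 + lo i) (2 + hi j) loᵢ≤r r≤hiⱼ)

  shifted-interval : ∀ r δ j → IsNat r (2 + δ) → r ∈ᴵ interval j ⇔ (lo j ≤ δ × δ ≤ hi j)
  shifted-interval r δ j r≡2+δ = mk⇔
    (λ r∈ → let p , q = to r∈ in +-cancelˡ-≤ 2 _ _ p , +-cancelˡ-≤ 2 _ _ q)
    (λ (p , q) → from (+-monoʳ-≤ 2 p , +-monoʳ-≤ 2 q))
    where open Equivalence (∈-natInterval r {2 + δ} (+-monoʳ-≤ 2 (lo≤hi j)) r≡2+δ)

  singleton-isIntervalPCG : code top ≡ 0 → IsIntervalPCG k (grid ns ns≥1)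
  singleton-isIntervalPCG code-top≡0 = record
    { 1≤k         = 1≤k
    ; T           = one-vertex
    ; ζ           = λ _ → tt , inj₂ (λ _ → refl)
    ; ζ-bijective = (λ _ → all-equal _ _) , λ _ → bottom , λ _ → refl
    ; I           = interval
    ; disjoint    = intervals-disjoint
    ; adj⇔        = λ u v u≢v → contradiction (all-equal u v) u≢v
    }
    where
    code≡0 : ∀ u → code u ≡ 0
    code≡0 u = n≤0⇒n≡0 (≤-trans (code≤top u) (≤-reflexive code-top≡0))
    all-equal : ∀ u v → u ≡ v
    all-equal u v = code-injective (trans (code≡0 u) (sym (code≡0 v)))

  caterpillar-isIntervalPCG : 0 < code top → IsIntervalPCG k (grid ns ns≥1)
  caterpillar-isIntervalPCG 0<top = record
    { 1≤k         = 1≤k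
    ; T           = tree
    ; ζ           = leaf
    ; ζ-bijective = leaf-bijective
    ; I           = interval
    ; disjoint    = intervals-disjoint
    ; adj⇔        = λ u v u≢v → mk⇔
        (λ uv → let j , p = Equivalence.to (adj⇔∣gap∣ u v) uv in
                j , Equivalence.from (at-leaves u≢v j) p)
        (λ (j , p) → Equivalence.from (adj⇔∣gap∣ u v) (j , Equivalence.to (at-leaves u≢v j) p))
    }
    where
    open Caterpillar (GridPoint ns) (Graph.finite (grid ns ns≥1)) (code top) 0<top
                     code code≤top bottom top code-bottom refl
    at-leaves : ∀ {u v} → u ≢ v → ∀ j →
                WeightedTree.dist tree (inj₂ u) (inj₂ v) ∈ᴵ interval j ⇔
                (lo j ≤ gap u v × gap u v ≤ hi j)
    at-leaves {u} {v} u≢v j =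
      shifted-interval (WeightedTree.dist tree (inj₂ u) (inj₂ v)) (gap u v) j (dist-leaves u≢v)

  grid-isIntervalPCG : IsIntervalPCG k (grid ns ns≥1)
  grid-isIntervalPCG with code top ≟ 0
  ... | yes top≡0 = singleton-isIntervalPCG top≡0
  ... | no  top≢0 = caterpillar-isIntervalPCG (n≢0⇒n>0 top≢0)

theorem3p1 : (d : ℕ) → 3 ≤ d → (ns : Vec ℕ d) (ns≥1 : All (1 ≤_) ns) →
    IsIntervalPCG (d ∸ 1) (grid ns ns≥1)
theorem3p1 (suc (suc d)) (s≤s (s≤s 1≤d)) ns ns≥1 =
  -- The matched `d` is the dimension minus two, so the code has `suc d` intervals, one fewer than
  -- the dimension.
  grid-isIntervalPCG ns≥1 (s≤s z≤n) (gridCode d ns ns≥1)
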